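{- Let $\mathcal{G}$ be a dynamic multigraph with finite vertex set $\mathcal{V}$ and finite edge set $\mathcal{E}$, and let $\mathcal{L}_{\mathcal{G}}$ be its increment-weighted line graph and $\mathcal{L}^*_{\mathcal{G}}=\bigcup_{i\in\mathcal{V}}\mathcal{M}_{\mathcal{G}}(i)$ its line graph skeleton, both as defined in the context. Then the weighted connectivities of $\mathcal{L}_{\mathcal{G}}$ and $\mathcal{L}^*_{\mathcal{G}}$ are equivalent: for every threshold $\omega\in\mathbb{R}$, $\mathrm{comps}(\mathcal{L}^*_{\mathcal{G}},\omega)=\mathrm{comps}(\mathcal{L}_{\mathcal{G}},\omega)$.
   Context: A dynamic multigraph $\mathcal{G}(\mathcal{V},\mathcal{E},\mathcal{T})$ consists of a finite vertex set $\mathcal{V}$ and a finite set $\mathcal{E}$ of directed timestamped edges $e_r=(i_r,j_r,t_r)$ with $i_r,j_r\in\mathcal{V}$, $i_r\neq j_r$ (no self loops), $t_r\in\mathcal{T}=[0,T]$; several edges may join the same ordered pair at different times, timestamps may tie across edges, and no two edges agree in both ordered vertex pair and timestamp. For $i\in\mathcal{V}$, $\mathcal{E}^{(in)}_i=\{e_r\in\mathcal{E}: j_r=i\}$, $\mathcal{E}^{(out)}_i=\{e_r\in\mathcal{E}: i_r=i\}$, $\mathcal{E}_i=\mathcal{E}^{(in)}_i\cup\mathcal{E}^{(out)}_i$. Increment-weighted line graph $\mathcal{L}_{\mathcal{G}}$: its vertex set is $\mathcal{E}$; for $e_r,e_s\in\mathcal{E}$ there is a directed edge $(e_r,e_s)$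 with weight $w_{rs}=t_s-t_r$ if and only if $j_r=i_s$ (tip-to-tail) and $t_r\le t_s$. Line graph skeleton: for each $i\in\mathcal{V}$, the set $\mathcal{M}_{\mathcal{G}}(i)$ is produced as follows. Sort $\mathcal{E}_i$ by timestamp, with incoming edges placed before outgoing edges when timestamps are equal. Start with an empty list $W$ and an empty output. Process the edges of $\mathcal{E}_i$ in sorted order: if the current edge $e_j$ is incoming to $i$, append it to $W$; if it is outgoing from $i$, then for every $e_k\in W$ add the pair $(e_k,e_j)$ to the output, and then replace $W$ by the one-element list consisting of the last element of $W$ (leaving $W$ empty if it was empty). Each output pair $(e_k,e_j)$ is an edge with weight $t_j-t_k$. $\mathcal{L}^*_{\mathcal{G}}$ is the weighted graph on vertex set $\mathcal{E}$ whose edge set is the union over all $i\in\mathcal{V}$ of these outputs. Weight-filtered connected components: for a weighted graph $\mathcal{H}$ and threshold $\omega$, $\mathrm{comps}(\mathcal{H},\omega)$ is the set of connected components (ignoring edge directions) of the graph on the same vertex set that keeps only the edges of weight $\le\omega$. Two weighted graphs on the same vertex set have equivalent weighted connectivities if their weight-filtered connected components coincide for every $\omega$. -}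

module Defs where

open import Data.Fin.Base using (Fin)
open import Data.Fin.Properties using (_≟_)
open import Data.List.Base using (List; []; _∷_; _∷ʳ_; _++_; map; filter; allFin; last; fromMaybe)
open import Data.List.Membership.Propositional using (_∈_)
open import Data.List.Relation.Binary.Permutation.Propositional using (_↭_)
open import Data.List.Relation.Unary.AllPairs using (AllPairs)
open import Data.Nat.Base as ℕ using (ℕ; _⊔_)
open import Data.Nat.Properties using (m⊔n≤o⇒m≤o; m⊔n≤o⇒n≤o)
open import Data.Product using (Σ-syntax; ∃-syntax; _×_; _,_; proj₁; proj₂)
open import Data.Rational.Base as ℚ using (ℚ; 0ℚ; ½)
import Data.Rational.Properties as ℚ
open import Data.Rational.Solver using (module +-*-Solver)
open import Data.Sum.Base using (_⊎_)
open import Level using (0ℓ)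
open import Relation.Binary.Construct.Closure.Equivalence using (EqClosure)
open import Relation.Binary.PropositionalEquality using (_≡_; _≢_; refl; sym; trans; cong; subst)
open import Relation.Nullary using (¬_; Dec; yes; no)
open import Relation.Nullary.Decidable using (_⊎-dec_)
open import Relation.Unary using (Pred; _≐_)

-- Real numbers as Cauchy sequences of rationals. They form a setoid: equality
-- of reals is _≈_ below, not _≡_.

record ℝ : Set where
  field
    seq    : ℕ → ℚ
    cauchy : ∀ ε → 0ℚ ℚ.< ε →
             ∃[ N ] (∀ m n → N ℕ.≤ m → N ℕ.≤ n → ℚ.∣ seq m ℚ.- seq n ∣ ℚ.< ε)

open ℝ public

infix  4 _≤_ _≈_
infixl 6 _-_

_≤_ : ℝ → ℝ → Set
x ≤ y = ∀ ε → 0ℚ ℚ.< ε → ∃[ N ] (∀ n → N ℕ.≤ n → seq x n ℚ.≤ seq y n ℚ.+ ε)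

_≈_ : ℝ → ℝ → Set
x ≈ y = x ≤ y × y ≤ x

0ℝ : ℝ
0ℝ .seq    _       = 0ℚ
0ℝ .cauchy ε 0<ε = 0 , λ _ _ _ _ → 0<ε

½*ε+½*ε≡ε : ∀ ε → ½ ℚ.* ε ℚ.+ ½ ℚ.* ε ≡ ε
½*ε+½*ε≡ε ε = trans (sym (ℚ.*-distribʳ-+ ε ½ ½)) (ℚ.*-identityˡ ε)

0<½*ε : ∀ {ε} → 0ℚ ℚ.< ε → 0ℚ ℚ.< ½ ℚ.* ε
0<½*ε {ε} 0<ε = subst (ℚ._< ½ ℚ.* ε) (ℚ.*-zeroʳ ½) (ℚ.*-monoʳ-<-pos ½ 0<ε)

_-_ : ℝ → ℝ → ℝ
(x - y) .seq n = seq x n ℚ.- seq y n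
(x - y) .cauchy ε 0<ε = M ⊔ N , close
  where
  M = proj₁ (cauchy x (½ ℚ.* ε) (0<½*ε 0<ε))
  N = proj₁ (cauchy y (½ ℚ.* ε) (0<½*ε 0<ε))

  rearrange : ∀ a b c d → (a ℚ.- b) ℚ.- (c ℚ.- d) ≡ (a ℚ.- c) ℚ.- (b ℚ.- d)
  rearrange = solve 4 (λ a b c d → (a :- b) :- (c :- d) := (a :- c) :- (b :- d)) refl
    where open +-*-Solver

  close : ∀ m n → M ⊔ N ℕ.≤ m → M ⊔ N ℕ.≤ n →
          ℚ.∣ (seq x m ℚ.- seq y m) ℚ.- (seq x n ℚ.- seq y n) ∣ ℚ.< ε
  close m n p q = begin-strict
    ℚ.∣ (seq x m ℚ.- seq y m) ℚ.- (seq x n ℚ.- seq y n) ∣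
      ≡⟨ cong ℚ.∣_∣ (rearrange (seq x m) (seq y m) (seq x n) (seq y n)) ⟩
    ℚ.∣ (seq x m ℚ.- seq x n) ℚ.- (seq y m ℚ.- seq y n) ∣
      ≤⟨ ℚ.∣p-q∣≤∣p∣+∣q∣ (seq x m ℚ.- seq x n) (seq y m ℚ.- seq y n) ⟩
    ℚ.∣ seq x m ℚ.- seq x n ∣ ℚ.+ ℚ.∣ seq y m ℚ.- seq y n ∣
      <⟨ ℚ.+-mono-<
           (proj₂ (cauchy x _ (0<½*ε 0<ε)) m n (m⊔n≤o⇒m≤o M N p) (m⊔n≤o⇒m≤o M N q))
           (proj₂ (cauchy y _ (0<½*ε 0<ε)) m n (m⊔n≤o⇒n≤o M N p) (m⊔n≤o⇒n≤o M N q)) ⟩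
    ½ ℚ.* ε ℚ.+ ½ ℚ.* ε
      ≡⟨ ½*ε+½*ε≡ε ε ⟩
    ε ∎
    where open ℚ.≤-Reasoning

record DynamicMultigraph : Set where
  field
    #V #E : ℕ

  V = Fin #V
  E = Fin #E

  field
    src tgt  : E → V
    time     : E → ℝ
    T        : ℝ
    0≤time   : ∀ e → 0ℝ ≤ time e
    time≤T   : ∀ e → time e ≤ T
    noLoop   : ∀ e → src e ≢ tgt e
    distinct : ∀ e f → src e ≡ src f → tgt e ≡ tgt f → time e ≈ time f → e ≡ f

  Incident : V → E → Set
  Incident i e = tgt e ≡ i ⊎ src e ≡ i

  incident? : ∀ i e → Dec (Incident i e)
  incident? i e = (tgt e ≟ i) ⊎-dec (src e ≟ i)

  incidentEdges : V → List E
  incidentEdges i = filter (incident? i) (allFin #E)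

record WeightedGraph (A : Set) : Set₁ where
  field
    Edge   : A → A → Set
    weight : ∀ {a b} → Edge a b → ℝ

module _ {A : Set} where

  Connected : WeightedGraph A → ℝ → A → A → Set
  Connected H ω = EqClosure (λ a b → Σ[ e ∈ Edge a b ] weight e ≤ ω)
    where open WeightedGraph H

  comps : WeightedGraph A → ℝ → Pred (Pred A 0ℓ) 0ℓ
  comps H ω C = ∃[ a ] C ≐ Connected H ω a

  EquivalentWeightedConnectivity : WeightedGraph A → WeightedGraph A → Set₁
  EquivalentWeightedConnectivity H H′ = ∀ ω → comps H ω ≐ comps H′ ω

module _ (G : DynamicMultigraph) where
  open DynamicMultigraph G

  lineGraph : WeightedGraph E
  lineGraph = record
    { Edge   = λ r s → tgt r ≡ src s × time r ≤ time s
    ; weight = λ {r} {s} _ → time s - time r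
    }

  -- e may stand before f in the processing order at i. Two incoming, or two
  -- outgoing, edges with equal timestamps may stand in either order.
  Before : V → E → E → Set
  Before i e f = time e ≤ time f × (time e ≈ time f → ¬ (src e ≡ i × tgt f ≡ i))

  -- A choice, at every vertex, of a sorted list of its incident edges. The
  -- skeleton depends on how the remaining ties are broken, so it takes this
  -- choice as an argument. Excluded middle yields a Sorting of every G; without
  -- it, Cauchy reals cannot in general be compared, hence not sorted.
  record Sorting : Set where
    field
      sorted   : V → List E
      complete : ∀ i → sorted i ↭ incidentEdges i
      ordered  : ∀ i → AllPairs (Before i) (sorted i)

  -- The first list is W. An edge that is incident to i but not incoming is
  -- outgoing.
  process : V → List E → List E → List (E × E)
  process i W []       = []
  process i W (e ∷ es) with tgt e ≟ i
  ... | yes _ = process i (W ∷ʳ e) es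
  ... | no  _ = map (_, e) W ++ process i (fromMaybe (last W)) es

  skeletonAt : Sorting → V → List (E × E)
  skeletonAt σ i = process i [] (Sorting.sorted σ i)

  skeleton : Sorting → WeightedGraph E
  skeleton σ = record
    { Edge   = λ r s → ∃[ i ] (r , s) ∈ skeletonAt σ i
    ; weight = λ {r} {s} _ → time s - time r
    }

{-# OPTIONS --safe #-}

-- Every skeleton edge is a line graph edge of the same weight, so only line graph
-- edges r → s of weight at most ω have to be replaced by skeleton walks. Let i be
-- the common endpoint. The tie rule puts r before s, and r is in W right after it
-- is processed. Let e be the first outgoing edge at i processed from then on, and w
-- the last element of W at that moment. If e is s, then r → s is in the skeleton.
-- Otherwise r → e and w → e are, both of weight at most time s - time r because
-- time r ≤ time w ≤ time e ≤ time s, and W becomes [ w ]: repeat with w for r.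
module Submission where

open import Defs

open import Data.Empty using (⊥-elim)
open import Data.Fin.Properties using (_≟_)
open import Data.List.Base using (List; []; _∷_; _∷ʳ_; _++_; allFin; last; fromMaybe)
open import Data.List.Membership.Propositional using (_∈_)
open import Data.List.Membership.Propositional.Properties
  using (∈-++⁺ˡ; ∈-++⁺ʳ; ∈-map⁺; ∈-filter⁺; ∈-filter⁻; ∈-allFin)
open import Data.List.Properties using (∷ʳ-++)
open import Data.List.Relation.Binary.Permutation.Propositional using (↭-sym)
open import Data.List.Relation.Binary.Permutation.Propositional.Properties using (∈-resp-↭)
open import Data.List.Relation.Binary.Sublist.Propositional
  using (_⊆_; []; _∷_; ⊆-refl; lookup) renaming (_∷ʳ_ to skip)
open import Data.List.Relation.Binary.Sublist.Propositional.Properties using (++⁺; ++⁺ʳ)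
open import Data.List.Relation.Unary.All as All using (All; []; _∷_)
import Data.List.Relation.Unary.All.Properties as All
open import Data.List.Relation.Unary.AllPairs as AllPairs using (AllPairs; []; _∷_)
open import Data.List.Relation.Unary.Any using (here; there)
open import Data.Nat.Base using (_⊔_)
open import Data.Nat.Properties using (m⊔n≤o⇒m≤o; m⊔n≤o⇒n≤o)
open import Data.Product using (∃-syntax; _×_; _,_; proj₁; proj₂)
open import Data.Rational.Base as ℚ using (½)
import Data.Rational.Properties as ℚ
open import Data.Rational.Solver using (module +-*-Solver)
open import Data.Sum.Base using (inj₁; inj₂)
open import Level using (0ℓ)
import Relation.Binary.Construct.Closure.Equivalence as EqC
open import Relation.Binary.Core using (Rel)
open import Relation.Binary.Definitions using (Reflexive)
open import Relation.Binary.PropositionalEquality using (_≡_; refl; sym; trans; cong; subst)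
open import Relation.Binary.Structures using (IsEquivalence)
open import Relation.Nullary using (yes; no; contradiction)

≤-refl : ∀ {x} → x ≤ x
≤-refl {x} ε 0<ε = 0 , λ n _ →
  subst (ℚ._≤ seq x n ℚ.+ ε) (ℚ.+-identityʳ _) (ℚ.+-monoʳ-≤ (seq x n) (ℚ.<⇒≤ 0<ε))

≤-trans : ∀ {x y z} → x ≤ y → y ≤ z → x ≤ z
≤-trans {x} {y} {z} x≤y y≤z ε 0<ε
  with M , p ← x≤y (½ ℚ.* ε) (0<½*ε 0<ε)
     | N , q ← y≤z (½ ℚ.* ε) (0<½*ε 0<ε) = M ⊔ N , λ n M⊔N≤n → begin
  seq x n                             ≤⟨ p n (m⊔n≤o⇒m≤o M N M⊔N≤n) ⟩
  seq y n ℚ.+ ½ ℚ.* ε                 ≤⟨ ℚ.+-monoˡ-≤ _ (q n (m⊔n≤o⇒n≤o M N M⊔N≤n)) ⟩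
  seq z n ℚ.+ ½ ℚ.* ε ℚ.+ ½ ℚ.* ε     ≡⟨ ℚ.+-assoc (seq z n) _ _ ⟩
  seq z n ℚ.+ (½ ℚ.* ε ℚ.+ ½ ℚ.* ε)   ≡⟨ cong (seq z n ℚ.+_) (½*ε+½*ε≡ε ε) ⟩
  seq z n ℚ.+ ε                       ∎
  where open ℚ.≤-Reasoning

-‿mono-≤ : ∀ {a b c d} → b ≤ d → c ≤ a → b - a ≤ d - c
-‿mono-≤ {a} {b} {c} {d} b≤d c≤a ε 0<ε
  with M , p ← b≤d (½ ℚ.* ε) (0<½*ε 0<ε)
     | N , q ← c≤a (½ ℚ.* ε) (0<½*ε 0<ε) = M ⊔ N , λ n M⊔N≤n → begin
  seq b n ℚ.- seq a n
    -- Adding and subtracting `seq c n` makes the positive part `b + c`, which the sum of the two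
    -- hypotheses bounds by `d + a`. Each contributes an error of half of `ε`.
    ≡⟨ addCancel (seq a n) (seq b n) (seq c n) ⟩
  (seq b n ℚ.+ seq c n) ℚ.- (seq a n ℚ.+ seq c n)
    ≤⟨ ℚ.+-monoˡ-≤ (ℚ.- (seq a n ℚ.+ seq c n))
         (ℚ.+-mono-≤ (p n (m⊔n≤o⇒m≤o M N M⊔N≤n)) (q n (m⊔n≤o⇒n≤o M N M⊔N≤n))) ⟩
  ((seq d n ℚ.+ ½ ℚ.* ε) ℚ.+ (seq a n ℚ.+ ½ ℚ.* ε)) ℚ.- (seq a n ℚ.+ seq c n)
    ≡⟨ cancel (seq a n) (seq c n) (seq d n) (½ ℚ.* ε) ⟩
  (seq d n ℚ.- seq c n) ℚ.+ (½ ℚ.* ε ℚ.+ ½ ℚ.* ε)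
    ≡⟨ cong (seq d n ℚ.- seq c n ℚ.+_) (½*ε+½*ε≡ε ε) ⟩
  (seq d n ℚ.- seq c n) ℚ.+ ε ∎
  where
  open ℚ.≤-Reasoning
  open +-*-Solver

  addCancel : ∀ a b c → b ℚ.- a ≡ (b ℚ.+ c) ℚ.- (a ℚ.+ c)
  addCancel = solve 3 (λ a b c → b :- a := (b :+ c) :- (a :+ c)) refl

  cancel : ∀ a c d h → ((d ℚ.+ h) ℚ.+ (a ℚ.+ h)) ℚ.- (a ℚ.+ c) ≡ (d ℚ.- c) ℚ.+ (h ℚ.+ h)
  cancel = solve 4 (λ a c d h → ((d :+ h) :+ (a :+ h)) :- (a :+ c) := (d :- c) :+ (h :+ h)) refl

module _ {A : Set} where

  last-⊆ : (xs : List A) → fromMaybe (last xs) ⊆ xs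
  last-⊆ []           = []
  last-⊆ (x ∷ [])     = ⊆-refl
  last-⊆ (x ∷ y ∷ xs) = skip x (last-⊆ (y ∷ xs))

  last-nonempty : (x : A) (xs : List A) → ∃[ w ] w ∈ fromMaybe (last (x ∷ xs))
  last-nonempty x []       = x , here refl
  last-nonempty _ (y ∷ ys) = last-nonempty y ys

  module _ {R : Rel A 0ℓ} where

    AllPairs-resp-⊇ : ∀ {xs ys} → xs ⊆ ys → AllPairs R ys → AllPairs R xs
    AllPairs-resp-⊇ []         []       = []
    AllPairs-resp-⊇ (skip _ τ) (_ ∷ ps) = AllPairs-resp-⊇ τ ps
    AllPairs-resp-⊇ (refl ∷ τ) (p ∷ ps) =
      All.tabulate (λ x∈ → All.lookup p (lookup τ x∈)) ∷ AllPairs-resp-⊇ τ ps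

    AllPairs-cross : ∀ {xs ys x y} → AllPairs R (xs ++ ys) → x ∈ xs → y ∈ ys → R x y
    AllPairs-cross {xs = _ ∷ xs} (p ∷ _)  (here refl) y∈ = All.lookup p (∈-++⁺ʳ xs y∈)
    AllPairs-cross               (_ ∷ ps) (there x∈)  y∈ = AllPairs-cross ps x∈ y∈

    -- The witness lies in `fromMaybe (last xs)` because that is the list with which `process`
    -- continues after an outgoing edge. Reflexivity covers the case where `x` is itself the last
    -- element.
    last-maximum : Reflexive R → ∀ {xs x} → AllPairs R xs → x ∈ xs →
                   ∃[ w ] w ∈ fromMaybe (last xs) × R x w
    last-maximum rfl {_ ∷ []}     _        (here refl) = _ , here refl , rfl
    last-maximum rfl {_ ∷ y ∷ xs} (p ∷ _)  (here refl)
      with _ , w∈ ← last-nonempty y xs = _ , w∈ , All.lookup p (lookup (last-⊆ (y ∷ xs)) w∈)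
    last-maximum rfl {_ ∷ _ ∷ _}  (_ ∷ ps) (there x∈)  = last-maximum rfl ps x∈

module _ {A : Set} (H H′ : WeightedGraph A) where

  -- Even one inclusion takes both implications, since a component of `H` has to be exactly a
  -- component of `H′`. The representative `a` is kept.
  comps-⊆ : ∀ ω → (∀ {a b} → Connected H ω a b → Connected H′ ω a b) →
            (∀ {a b} → Connected H′ ω a b → Connected H ω a b) →
            ∀ {C} → comps H ω C → comps H′ ω C
  comps-⊆ ω to from (a , C⊆ , ⊆C) = a , (λ c → to (C⊆ c)) , (λ c → ⊆C (from c))

module _ (G : DynamicMultigraph) where
  open DynamicMultigraph G

  private
    Sorted : List E → Set
    Sorted = AllPairs (λ e f → time e ≤ time f)

    LineEdge : E × E → Set
    LineEdge (r , s) = tgt r ≡ src s × time r ≤ time s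

  Sorted-shift : ∀ W e {es} → Sorted (W ++ e ∷ es) → Sorted ((W ∷ʳ e) ++ es)
  Sorted-shift W e {es} = subst Sorted (sym (∷ʳ-++ W e es))

  -- The reset only drops elements: `e` and all of `W` but its last entry. With `Sorted-shift` this
  -- keeps the window followed by the unprocessed edges sorted throughout the run.
  Sorted-reset : ∀ W e {es} → Sorted (W ++ e ∷ es) → Sorted (fromMaybe (last W) ++ es)
  Sorted-reset W e = AllPairs-resp-⊇ (++⁺ (last-⊆ W) (skip e ⊆-refl))

  -- Invariant: `W` holds only edges incoming to `i`, and they precede all unprocessed ones. So an
  -- outgoing `e` is tip-to-tail with every entry of `W` and no earlier than it.
  process-⊆-lineGraph : ∀ i W es → Sorted (W ++ es) →
                        All (λ e → tgt e ≡ i) W → All (Incident i) es →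
                        All LineEdge (process G i W es)
  process-⊆-lineGraph i W []       _  _  _        = []
  process-⊆-lineGraph i W (e ∷ es) so ws (p ∷ ps) with tgt e ≟ i
  ... | yes e→i = process-⊆-lineGraph i (W ∷ʳ e) es (Sorted-shift W e so) (All.∷ʳ⁺ ws e→i) ps
  ... | no ¬e→i = All.++⁺
    (All.map⁺ (All.tabulate λ w∈ →
      trans (All.lookup ws w∈) (sym (outgoing p)) , AllPairs-cross so w∈ (here refl)))
    (process-⊆-lineGraph i (fromMaybe (last W)) es (Sorted-reset W e so)
      (All.tabulate λ w∈ → All.lookup ws (lookup (last-⊆ W) w∈)) ps)
    where
    outgoing : Incident i e → src e ≡ i
    outgoing (inj₁ e→i) = contradiction e→i ¬e→i
    outgoing (inj₂ i→e) = i→e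

  module _ {ω : ℝ} {_~_ : Rel E 0ℓ} (eq : IsEquivalence _~_) where
    private module ~ = IsEquivalence eq

    -- _~_ stays fixed while W and the remaining edges change along the recursion.
    Joins : List (E × E) → Set
    Joins ps = ∀ {a b} → (a , b) ∈ ps → time b - time a ≤ ω → a ~ b

    -- Induction on the unprocessed edges, with `r` replaced at each reset by the surviving entry
    -- `w` of the window. Since `w` is no earlier than `r`, the bound by `ω` persists.
    window-joined : ∀ i W es → Sorted (W ++ es) → Joins (process G i W es) →
                    ∀ {r s} → r ∈ W → s ∈ es → src s ≡ i → time s - time r ≤ ω → r ~ s
    window-joined i W (e ∷ es) so joins {r} {s} r∈ s∈ i→s rs≤ω with tgt e ≟ i
    window-joined i W (e ∷ es) so joins {r} {s} r∈ (here refl) i→s rs≤ω | yes e→i =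
      contradiction (trans i→s (sym e→i)) (noLoop e)
    window-joined i W (e ∷ es) so joins {r} {s} r∈ (there s∈) i→s rs≤ω | yes _ =
      window-joined i (W ∷ʳ e) es (Sorted-shift W e so) joins (∈-++⁺ˡ r∈) s∈ i→s rs≤ω
    window-joined i W (e ∷ es) so joins {r} {s} r∈ (here refl) i→s rs≤ω | no _ =
      joins (∈-++⁺ˡ (∈-map⁺ (_, e) r∈)) rs≤ω
    window-joined i W (e ∷ es) so joins {r} {s} r∈ (there s∈) i→s rs≤ω | no _
      with w , w∈ , r≤w ← last-maximum (λ {x} → ≤-refl {time x})
                            (AllPairs-resp-⊇ (++⁺ʳ (e ∷ es) ⊆-refl) so) r∈ =
      -- The walk goes from `r` forward to `e`, backward to `w`, and on to `s` by induction; the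
      -- recursive call's output is a suffix of the current one.
      ~.trans (join r∈ (≤-refl {time r})) (~.trans (~.sym (join (lookup (last-⊆ W) w∈) r≤w))
        (window-joined i (fromMaybe (last W)) es so′ (λ p → joins (∈-++⁺ʳ _ p)) w∈ s∈ i→s
          (narrower (≤-refl {time s}) r≤w)))
      where
      so′ = Sorted-reset W e so

      narrower : ∀ {x f} → time f ≤ time s → time r ≤ time x → time f - time x ≤ ω
      narrower {x} {f} f≤s r≤x = ≤-trans {time f - time x} {time s - time r} {ω}
        (-‿mono-≤ {time x} {time f} {time r} {time s} f≤s r≤x) rs≤ω

      e≤s : time e ≤ time s
      -- Shifting `e` into the left part puts `e` and `s` on opposite sides of the split.
      e≤s = AllPairs-cross (Sorted-shift W e so) (∈-++⁺ʳ W (here refl)) s∈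

      join : ∀ {x} → x ∈ W → time r ≤ time x → x ~ e
      join x∈ r≤x = joins (∈-++⁺ˡ (∈-map⁺ (_, e) x∈)) (narrower e≤s r≤x)

    -- The run is followed until `r` is processed; `r` is then in the window, with `s` still to
    -- come, and `window-joined` takes over.
    process-joined : ∀ i W es → AllPairs (Before G i) es → Sorted (W ++ es) →
                     Joins (process G i W es) →
                     ∀ {r s} → r ∈ es → s ∈ es → tgt r ≡ i → src s ≡ i →
                     time r ≤ time s → time s - time r ≤ ω → r ~ s
    process-joined i W (e ∷ es) _        so joins (here refl) (here refl) r→i i→s r≤s rs≤ω =
      contradiction (trans i→s (sym r→i)) (noLoop e)
    process-joined i W (e ∷ es) (b ∷ _)  so joins (there r∈)  (here refl) r→i i→s r≤s rs≤ω
      -- If `s` came first, the two times would be equal, and the tie rule forbids an outgoing edge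
      -- before an incoming one.
      with s≤r , ¬tie ← All.lookup b r∈ = ⊥-elim (¬tie (s≤r , r≤s) (i→s , r→i))
    process-joined i W (e ∷ es) _        so joins _           (there s∈)  r→i i→s r≤s rs≤ω
      with tgt e ≟ i
    process-joined i W (e ∷ es) _        so joins (here refl) (there s∈)  r→i i→s r≤s rs≤ω
      | yes _   = window-joined i (W ∷ʳ e) es (Sorted-shift W e so) joins
                    (∈-++⁺ʳ W (here refl)) s∈ i→s rs≤ω
    process-joined i W (e ∷ es) _        so joins (here refl) (there s∈)  r→i i→s r≤s rs≤ω
      | no ¬r→i = contradiction r→i ¬r→i
    process-joined i W (e ∷ es) (_ ∷ bs) so joins (there r∈)  (there s∈)  r→i i→s r≤s rs≤ω
      | yes _   = process-joined i (W ∷ʳ e) es bs (Sorted-shift W e so) joins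
                    r∈ s∈ r→i i→s r≤s rs≤ω
    process-joined i W (e ∷ es) (_ ∷ bs) so joins (there r∈)  (there s∈)  r→i i→s r≤s rs≤ω
      | no _    = process-joined i (fromMaybe (last W)) es bs (Sorted-reset W e so)
                    (λ p → joins (∈-++⁺ʳ _ p)) r∈ s∈ r→i i→s r≤s rs≤ω

  module _ (σ : Sorting G) where
    open Sorting σ

    sorted-incident : ∀ i → All (Incident i) (sorted i)
    sorted-incident i = All.tabulate λ e∈ →
      proj₂ (∈-filter⁻ (incident? i) {xs = allFin #E} (∈-resp-↭ (complete i) e∈))

    incident-sorted : ∀ i {e} → Incident i e → e ∈ sorted i
    incident-sorted i inc =
      ∈-resp-↭ (↭-sym (complete i)) (∈-filter⁺ (incident? i) (∈-allFin _) inc)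

    sorted-Sorted : ∀ i → Sorted (sorted i)
    sorted-Sorted i = AllPairs.map proj₁ (ordered i)

    skeleton⇒lineGraph : ∀ ω {r s} → Connected (skeleton G σ) ω r s →
                         Connected (lineGraph G) ω r s
    skeleton⇒lineGraph ω = EqC.map λ ((i , rs∈) , rs≤ω) →
      All.lookup
        (process-⊆-lineGraph i [] (sorted i) (sorted-Sorted i) [] (sorted-incident i)) rs∈ ,
      -- Both graphs give the pair the weight `time s - time r`, so the bound carries over
      -- unchanged.
      rs≤ω

    lineGraph⇒skeleton : ∀ ω {r s} → Connected (lineGraph G) ω r s →
                         Connected (skeleton G σ) ω r s
    -- Folding into the equivalence `Connected (skeleton G σ) ω` leaves single line graph edges,
    -- each handled at the vertex `src s` where `r` and `s` meet.
    lineGraph⇒skeleton ω = EqC.fold (EqC.isEquivalence _)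
      λ {r} {s} ((r→s , r≤s) , rs≤ω) → let i = src s in
      process-joined {ω} (EqC.isEquivalence _) i [] (sorted i) (ordered i) (sorted-Sorted i)
        (λ p p≤ω → EqC.return ((i , p) , p≤ω))
        (incident-sorted i (inj₁ r→s)) (incident-sorted i (inj₂ refl)) r→s refl r≤s rs≤ω

mainTheorem1 : (G : DynamicMultigraph) (σ : Sorting G) →
    EquivalentWeightedConnectivity (skeleton G σ) (lineGraph G)
mainTheorem1 G σ ω =
  comps-⊆ (skeleton G σ) (lineGraph G) ω to from , comps-⊆ (lineGraph G) (skeleton G σ) ω from to
  where
  to : ∀ {r s} → Connected (skeleton G σ) ω r s → Connected (lineGraph G) ω r s
  to = skeleton⇒lineGraph G σ ω

  from : ∀ {r s} → Connected (lineGraph G) ω r s → Connected (skeleton G σ) ω r s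
  from = lineGraph⇒skeleton G σ ω
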